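{- The following collection principle is $\mathcal I^{\mathrm{cb}}$-interpretable: $$\forall f\le_{\mathbb N\to\mathbb N}1\ \exists n^{\mathbb N}\,C(f,n)\ \to\ \exists k^{\mathbb N}\,\forall f\le_{\mathbb N\to\mathbb N}1\ \exists n\le k\,C(f,n),$$ for arbitrary formulas $C(f,n)$ of the source language (that of $\mathrm{HA}^\omega$).
   Context: Source. $\mathrm{HA}^\omega$ is Heyting arithmetic in all finite types generated by $\sigma\to\tau$ from ground types $\mathbb N$ and $\mathbb B$ (Booleans), with combinators, $0$, successor, recursors, Boolean constants and conditionals; its only relation symbols are logical equalities $\equiv_\sigma$. Formulas use $\bot,\wedge,\to,\forall x^\sigma,\exists x^\sigma$ and the following primitive restricted quantifiers. $n\le k$ abbreviates a quantifier-free equation of type $\mathbb N$. $\forall n\le k\,A$, $\exists n\le k\,A$ are axiomatized as equivalent to $\forall n(n\le k\to A)$, $\exists n(n\le k\wedge A)$; $\forall f\le_{\mathbb N\to\mathbb N}1\,A$, $\exists f\le_{\mathbb N\to\mathbb N}1\,A$ are axiomatized as equivalent to $\forall f^{\mathbb N\to\mathbb N}(\forall n^{\mathbb N}(fn\le1)\to A)$, $\exists f^{\mathbb N\to\mathbb N}(\forall n^{\mathbb N}(fn\le1)\wedge A)$. Target. Target language: the language of $\mathrm{HA}^\omega$ with the extra type constructor $\sigma\mapsto\sigma^*$ (non-empty finite subsets) and constants for singleton, union, indexed union, membership, combinators and recursors for all these types, and $\mathrm m:\mathbb N^*\to\mathbb N$ (maximum). $\mathcal S^\omega_*$: $\mathcal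 S_{\mathbb N}=\mathbb N$, $\mathcal S_{\mathbb B}=\{0,1\}$, $\mathcal S_{\rho\to\sigma}$ all functions, $\mathcal S_{\sigma^*}$ all non-empty finite subsets of $\mathcal S_\sigma$. The target theory $T$ is the set of sentences true in $\mathcal S^\omega_*$. Witnessing types are generated from $\mathbb N$ by $\to$ and $*$; witnessing terms are terms of such types. $\mathcal L^{\mathcal I}$ adds to the language of $\mathrm{HA}^\omega$ (without restricted quantifiers) a unary predicate $\mathcal I_\sigma(x^\sigma)$ for each type. Boldface letters are (possibly empty) tuples; $\forall\boldsymbol b\in\boldsymbol B$ is componentwise. $\mathcal I^{\mathrm{cb}}$ (canonical upon bounding): $\langle\mathcal I_{\mathbb N}(x)\rangle^n$ is $x\le n$; $\langle\mathcal I_{\mathbb B}(i)\rangle$ is true, without witnesses; $\langle\mathcal I_{\rho\to\sigma}(h)\rangle^{\boldsymbol f,\boldsymbol g}_{\boldsymbol a,\boldsymbol d}:\equiv\forall x^\rho(\forall\boldsymbol b\in\boldsymbol g\boldsymbol a\boldsymbol d\,\langle\mathcal I_\rho(x)\rangle^{\boldsymbol a}_{\boldsymbol b}\to\langle\mathcal I_\sigma(hx)\rangle^{\boldsymbol f\boldsymbol a}_{\boldsymbol d})$. $\mathcal U$-interpretation: $\langle x\equiv_\sigma y\rangle$ is $x=y$; $\langle\bot\rangle:\equiv\bot$; $\langle A\wedge B\rangle^{\boldsymbol a,\boldsymbol c}_{\boldsymbol b,\boldsymbol d}:\equiv\langle A\rangle^{\boldsymbol a}_{\boldsymbol b}\wedge\langle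 B\rangle^{\boldsymbol c}_{\boldsymbol d}$; $\langle A\to B\rangle^{\boldsymbol f,\boldsymbol g}_{\boldsymbol a,\boldsymbol d}:\equiv\forall\boldsymbol b\in\boldsymbol g\boldsymbol a\boldsymbol d\,\langle A\rangle^{\boldsymbol a}_{\boldsymbol b}\to\langle B\rangle^{\boldsymbol f\boldsymbol a}_{\boldsymbol d}$; $\langle\forall xA\rangle^{\boldsymbol a}_{\boldsymbol b}:\equiv\forall x\langle A\rangle^{\boldsymbol a}_{\boldsymbol b}$; $\langle\exists xA\rangle^{\boldsymbol a}_{\boldsymbol B}:\equiv\exists x\forall\boldsymbol b\in\boldsymbol B\langle A\rangle^{\boldsymbol a}_{\boldsymbol b}$. $A(\boldsymbol x)$ is $\mathcal U$-interpretable if there are closed witnessing terms $\boldsymbol t$ with $T\vdash\forall\boldsymbol b\langle A(\boldsymbol x)\rangle^{\boldsymbol t}_{\boldsymbol b}$. Relativization: $A^{\mathcal I}$ commutes with connectives; $(\forall x^\sigma A)^{\mathcal I}:\equiv\forall x^\sigma(\mathcal I_\sigma(x)\to A^{\mathcal I})$; $(\exists x^\sigma A)^{\mathcal I}:\equiv\exists x^\sigma(\mathcal I_\sigma(x)\wedge A^{\mathcal I})$; for restricted quantifiers with restricting formula $B(x)$ (namely $n\le k$, resp. $\forall n(fn\le1)$), the quantifier is relativized to $B^{\mathcal I}$ only: $\forall x(B(x)^{\mathcal I}\to A^{\mathcal I})$, $\exists x(B(x)^{\mathcal I}\wedge A^{\mathcal I})$, where $(n\le k)^{\mathcal I}$ is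 $n\le k$ and $(\forall n(fn\le1))^{\mathcal I}$ is $\forall n(\mathcal I_{\mathbb N}(n)\to fn\le1)$. A formula $A(\boldsymbol x)$ is $\mathcal I^{\mathrm{cb}}$-interpretable if $\forall\boldsymbol x(\mathcal I(\boldsymbol x)\to A(\boldsymbol x)^{\mathcal I})$ is $\mathcal U$-interpretable. -}

module Defs where

open import Data.Bool.Base using (Bool; if_then_else_)
import Data.Bool.Base as Bool
open import Data.Empty using () renaming (⊥ to Empty)
open import Data.List.Base using (List; []; _∷_; _++_; _ʳ++_; foldr; map)
open import Data.List.Extrema.Nat using (max; max-mono-⊆)
open import Data.List.Membership.Propositional using (_∈_)
import Data.List.Membership.Setoid as SetoidMembership
open import Data.List.NonEmpty.Base using (List⁺; toList; [_]; _⁺++⁺_; concatMap)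
open import Data.List.Relation.Binary.Subset.Propositional using (_⊆_)
open import Data.List.Relation.Binary.Subset.Propositional.Properties using (∷⁺ʳ)
import Data.List.Relation.Binary.Subset.Setoid as SetoidSubset
import Data.List.Relation.Binary.Subset.Setoid.Properties as SetoidSubsetProperties
open import Data.List.Relation.Unary.All as All using (All; []; _∷_)
open import Data.List.Relation.Unary.All.Properties as All using (++⁺; ++⁻ˡ; ++⁻ʳ; map⁺; map⁻)
open import Data.List.Relation.Unary.Any as Any using (Any; here; there)
import Data.List.Relation.Unary.Any.Properties as Any
open import Data.Nat.Base using (ℕ; z≤n)
import Data.Nat.Base as ℕ
import Data.Nat.Properties as ℕ
open import Data.Product.Base using (Σ; Σ-syntax; _×_; _,_; proj₁; proj₂)
open import Function.Base using (_∘_)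
open import Function.Bundles using (Func; _⟨$⟩_)
open import Function.Relation.Binary.Setoid.Equality using (_⇨_)
open import Level using (0ℓ)
open import Relation.Binary.Bundles using (Setoid)
open import Relation.Binary.PropositionalEquality as ≡ using (_≡_; refl)

------------------------------------------------------------------------
-- Types and terms

data Lang : Set where
  source target : Lang

infixr 7 _⇒_
infix  8 _*

data Ty : Lang → Set where
  N B : ∀ {L} → Ty L
  _⇒_ : ∀ {L} → Ty L → Ty L → Ty L
  _*  : Ty target → Ty target

data Const : ∀ {L} → Ty L → Set where
  𝐤         : ∀ {L} {σ τ : Ty L} → Const (σ ⇒ τ ⇒ σ)
  𝐬         : ∀ {L} {ρ σ τ : Ty L} → Const ((ρ ⇒ σ ⇒ τ) ⇒ (ρ ⇒ σ) ⇒ ρ ⇒ τ)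
  zero      : ∀ {L} → Const {L} N
  suc       : ∀ {L} → Const {L} (N ⇒ N)
  rec       : ∀ {L} {σ : Ty L} → Const (σ ⇒ (N ⇒ σ ⇒ σ) ⇒ N ⇒ σ)
  true      : ∀ {L} → Const {L} B
  false     : ∀ {L} → Const {L} B
  cond      : ∀ {L} {σ : Ty L} → Const (B ⇒ σ ⇒ σ ⇒ σ)
  singleton : ∀ {σ} → Const (σ ⇒ σ *)
  union     : ∀ {σ} → Const (σ * ⇒ σ * ⇒ σ *)
  ⋃         : ∀ {σ τ} → Const (σ * ⇒ (σ ⇒ τ *) ⇒ τ *)
  𝐦         : Const (N * ⇒ N)

Ctx : Lang → Set
Ctx L = List (Ty L)

infixl 9 _·_

-- Variables are de Bruijn indices: an index of type τ is a proof of τ ∈ Γ.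
data Tm {L} (Γ : Ctx L) : Ty L → Set where
  var : ∀ {τ} → τ ∈ Γ → Tm Γ τ
  con : ∀ {τ} → Const τ → Tm Γ τ
  _·_ : ∀ {σ τ} → Tm Γ (σ ⇒ τ) → Tm Γ σ → Tm Γ τ

Tms : ∀ {L} → Ctx L → List (Ty L) → Set
Tms Γ τs = All (Tm Γ) τs

ren : ∀ {L} {Γ Δ : Ctx L} {τ} → Γ ⊆ Δ → Tm Γ τ → Tm Δ τ
ren r (var x) = var (r x)
ren r (con c) = con c
ren r (t · u) = ren r t · ren r u

rens : ∀ {L} {Γ Δ : Ctx L} {τs} → Γ ⊆ Δ → Tms Γ τs → Tms Δ τs
rens r = All.map (ren r)

var₀ : ∀ {L} {Γ : Ctx L} {σ} → Tm (σ ∷ Γ) σ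
var₀ = var (here refl)

var₁ : ∀ {L} {Γ : Ctx L} {σ τ} → Tm (τ ∷ σ ∷ Γ) σ
var₁ = var (there (here refl))

𝟎 𝟏 : ∀ {L} {Γ : Ctx L} → Tm Γ N
𝟎 = con zero
𝟏 = con suc · 𝟎

-- Truncated subtraction, by recursion on the second argument, where
-- con rec · 𝟎 · con 𝐤 is the predecessor.  The abbreviation n ≤ k is rendered
-- throughout as the equation (n ∸ k) ≐ 𝟎.
infixl 6 _∸_

_∸_ : ∀ {L} {Γ : Ctx L} → Tm Γ N → Tm Γ N → Tm Γ N
n ∸ k = con rec · n · (con 𝐤 · (con rec · 𝟎 · con 𝐤)) · k

------------------------------------------------------------------------
-- Formulas

infix  5 _≐_ _∈̇_
infixr 4 _∧_
infixr 3 _⊃_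

-- HA^ω, with the primitive restricted quantifiers.
data Form (Γ : Ctx source) : Set where
  _≐_     : ∀ {σ} → Tm Γ σ → Tm Γ σ → Form Γ
  ⊥       : Form Γ
  _∧_ _⊃_ : Form Γ → Form Γ → Form Γ
  ∀̇ ∃̇     : ∀ σ → Form (σ ∷ Γ) → Form Γ
  ∀≤ ∃≤   : Tm Γ N → Form (N ∷ Γ) → Form Γ
  ∀≤1 ∃≤1 : Form ((N ⇒ N) ∷ Γ) → Form Γ

-- 𝓛^𝓘.
data Formᴵ (Γ : Ctx source) : Set where
  _≐_     : ∀ {σ} → Tm Γ σ → Tm Γ σ → Formᴵ Γ
  ⊥       : Formᴵ Γ
  _∧_ _⊃_ : Formᴵ Γ → Formᴵ Γ → Formᴵ Γ
  ∀̇ ∃̇     : ∀ σ → Formᴵ (σ ∷ Γ) → Formᴵ Γ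
  𝓘       : ∀ σ → Tm Γ σ → Formᴵ Γ

-- The target language; membership is a relation symbol.
data Form* (Δ : Ctx target) : Set where
  _≐_     : ∀ {σ} → Tm Δ σ → Tm Δ σ → Form* Δ
  _∈̇_     : ∀ {σ} → Tm Δ σ → Tm Δ (σ *) → Form* Δ
  ⊥       : Form* Δ
  _∧_ _⊃_ : Form* Δ → Form* Δ → Form* Δ
  ∀̇ ∃̇     : ∀ σ → Form* (σ ∷ Δ) → Form* Δ

renForm : ∀ {Γ Δ} → Γ ⊆ Δ → Form Γ → Form Δ
renForm r (t ≐ u)  = ren r t ≐ ren r u
renForm r ⊥        = ⊥
renForm r (A ∧ C)  = renForm r A ∧ renForm r C
renForm r (A ⊃ C)  = renForm r A ⊃ renForm r C
renForm r (∀̇ σ A)  = ∀̇ σ (renForm (∷⁺ʳ σ r) A)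
renForm r (∃̇ σ A)  = ∃̇ σ (renForm (∷⁺ʳ σ r) A)
renForm r (∀≤ k A) = ∀≤ (ren r k) (renForm (∷⁺ʳ N r) A)
renForm r (∃≤ k A) = ∃≤ (ren r k) (renForm (∷⁺ʳ N r) A)
renForm r (∀≤1 A)  = ∀≤1 (renForm (∷⁺ʳ (N ⇒ N) r) A)
renForm r (∃≤1 A)  = ∃≤1 (renForm (∷⁺ʳ (N ⇒ N) r) A)

------------------------------------------------------------------------
-- The standard structure 𝓢^ω_*
--
-- Each 𝓢_σ is a setoid: 𝓢_{σ⇒τ} consists of all functions respecting
-- equality, which is pointwise; a non-empty finite subset is a non-empty list
-- of elements, and two such are equal when they have the same members.
-- Truth of a formula is read in Agda's logic; no classical principle is assumed.

module _ (S : Setoid 0ℓ 0ℓ) where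
  open SetoidSubset S renaming (_⊆_ to _⊆ₛ_)

  infix 4 _≈⁺_

  _≈⁺_ : List⁺ (Setoid.Carrier S) → List⁺ (Setoid.Carrier S) → Set
  xs ≈⁺ ys = (toList xs ⊆ₛ toList ys) × (toList ys ⊆ₛ toList xs)

  finiteSubsets : Setoid 0ℓ 0ℓ
  finiteSubsets = record
    { Carrier       = List⁺ (Setoid.Carrier S)
    ; _≈_           = _≈⁺_
    ; isEquivalence = record
      { refl  = (λ p → p) , (λ p → p)
      ; sym   = λ (p , q) → q , p
      ; trans = λ (p , q) (p′ , q′) → (λ m → p′ (p m)) , (λ m → q (q′ m))
      }
    }

𝓢 : Ty target → Setoid 0ℓ 0ℓ
𝓢 N       = ≡.setoid ℕ
𝓢 B       = ≡.setoid Bool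
𝓢 (σ ⇒ τ) = 𝓢 σ ⇨ 𝓢 τ
𝓢 (σ *)   = finiteSubsets (𝓢 σ)

∣_∣ : Ty target → Set
∣ σ ∣ = Setoid.Carrier (𝓢 σ)

infix 4 _≈_ _∈ₛ_

_≈_ : ∀ {σ} → ∣ σ ∣ → ∣ σ ∣ → Set
_≈_ {σ} = Setoid._≈_ (𝓢 σ)

_∈ₛ_ : ∀ {σ} → ∣ σ ∣ → ∣ σ * ∣ → Set
_∈ₛ_ {σ} x X = SetoidMembership._∈_ (𝓢 σ) x (toList X)

≈-refl : ∀ σ {x : ∣ σ ∣} → _≈_ {σ} x x
≈-refl σ = Setoid.refl (𝓢 σ)

≈-trans : ∀ σ {x y z : ∣ σ ∣} → _≈_ {σ} x y → _≈_ {σ} y z → _≈_ {σ} x z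
≈-trans σ = Setoid.trans (𝓢 σ)

recursor : ∀ {A : Set} → A → (ℕ → A → A) → ℕ → A
recursor x f ℕ.zero    = x
recursor x f (ℕ.suc n) = f n (recursor x f n)

module _ {σ τ : Ty target} where
  ∈-⋃⁻ : ∀ {y} (X : ∣ σ * ∣) (f : ∣ σ ⇒ τ * ∣) →
         _∈ₛ_ {τ} y (concatMap (f ⟨$⟩_) X) →
         Any (λ x → _∈ₛ_ {τ} y (f ⟨$⟩ x)) (toList X)
  ∈-⋃⁻ X f = Any.map⁻ ∘ Any.map⁻ ∘ Any.concat⁻ (map toList (map (f ⟨$⟩_) (toList X)))

  ∈-⋃⁺ : ∀ {y} (X : ∣ σ * ∣) (f : ∣ σ ⇒ τ * ∣) →
         Any (λ x → _∈ₛ_ {τ} y (f ⟨$⟩ x)) (toList X) →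
         _∈ₛ_ {τ} y (concatMap (f ⟨$⟩_) X)
  ∈-⋃⁺ X f = Any.concat⁺ ∘ Any.map⁺ {f = toList} ∘ Any.map⁺ {f = f ⟨$⟩_}

  ⋃-⊆ : ∀ (X Y : ∣ σ * ∣) (f g : ∣ σ ⇒ τ * ∣) →
        (∀ {x} → _∈ₛ_ {σ} x X → _∈ₛ_ {σ} x Y) → _≈_ {σ ⇒ τ *} f g →
        ∀ {y} → _∈ₛ_ {τ} y (concatMap (f ⟨$⟩_) X) → _∈ₛ_ {τ} y (concatMap (g ⟨$⟩_) Y)
  ⋃-⊆ X Y f g X⊆Y f≈g y∈ with SetoidMembership.find (𝓢 σ) (∈-⋃⁻ X f y∈)
  ... | x , x∈X , y∈fx =
    ∈-⋃⁺ Y g (Any.map (λ {x′} x≈x′ → proj₁ (Func.cong g x≈x′) (proj₁ (f≈g x) y∈fx)) (X⊆Y x∈X))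

⟦_⟧ᶜ : ∀ {σ} → Const σ → ∣ σ ∣
⟦ 𝐤 {σ = σ} ⟧ᶜ = record
  { to   = λ x → record { to = λ _ → x ; cong = λ _ → ≈-refl σ {x} }
  ; cong = λ x≈x′ _ → x≈x′
  }
⟦ 𝐬 {τ = τ} ⟧ᶜ = record
  { to = λ f → record
    { to = λ g → record
      { to   = λ x → (f ⟨$⟩ x) ⟨$⟩ (g ⟨$⟩ x)
      ; cong = λ {x} {x′} x≈x′ → ≈-trans τ (Func.cong f x≈x′ (g ⟨$⟩ x))
                                           (Func.cong (f ⟨$⟩ x′) (Func.cong g x≈x′))
      }
    ; cong = λ g≈g′ x → Func.cong (f ⟨$⟩ x) (g≈g′ x)
    }
  ; cong = λ f≈f′ g x → f≈f′ x (g ⟨$⟩ x)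
  }
⟦ zero ⟧ᶜ = 0
⟦ suc ⟧ᶜ = record { to = ℕ.suc ; cong = ≡.cong ℕ.suc }
⟦ rec {σ = σ} ⟧ᶜ = record
  { to = λ x → record
    { to = λ f → record
      { to   = run x f
      ; cong = λ { {n} refl → ≈-refl σ {run x f n} }
      }
    ; cong = λ {f} {g} f≈g n → step x f g f≈g n
    }
  ; cong = λ x≈y f n → base f x≈y n
  }
  where
  run : ∣ σ ∣ → ∣ N ⇒ σ ⇒ σ ∣ → ℕ → ∣ σ ∣
  run x f = recursor x (λ n y → (f ⟨$⟩ n) ⟨$⟩ y)

  step : ∀ x f g → _≈_ {N ⇒ σ ⇒ σ} f g → ∀ n → _≈_ {σ} (run x f n) (run x g n)
  step x f g f≈g ℕ.zero    = ≈-refl σ {x}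
  step x f g f≈g (ℕ.suc n) =
    ≈-trans σ (f≈g n (run x f n)) (Func.cong (g ⟨$⟩ n) (step x f g f≈g n))

  base : ∀ {x y} f → _≈_ {σ} x y → ∀ n → _≈_ {σ} (run x f n) (run y f n)
  base f x≈y ℕ.zero    = x≈y
  base f x≈y (ℕ.suc n) = Func.cong (f ⟨$⟩ n) (base f x≈y n)
⟦ true ⟧ᶜ = Bool.true
⟦ false ⟧ᶜ = Bool.false
⟦ cond {σ = σ} ⟧ᶜ = record
  { to = λ b → record
    { to = λ x → record
      { to   = λ y → if b then x else y
      ; cong = λ y≈y′ → if-cong b (≈-refl σ {x}) y≈y′
      }
    ; cong = λ x≈x′ y → if-cong b x≈x′ (≈-refl σ {y})
    }
  ; cong = λ { {b} refl x y → if-cong b (≈-refl σ {x}) (≈-refl σ {y}) }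
  }
  where
  if-cong : ∀ b {x x′ y y′ : ∣ σ ∣} → _≈_ {σ} x x′ → _≈_ {σ} y y′ →
            _≈_ {σ} (if b then x else y) (if b then x′ else y′)
  if-cong Bool.true  p q = p
  if-cong Bool.false p q = q
⟦ singleton {σ} ⟧ᶜ = record
  { to   = [_]
  ; cong = λ x≈y → (λ { (here p) → here (≈-trans σ p x≈y) })
                 , (λ { (here p) → here (≈-trans σ p (Setoid.sym (𝓢 σ) x≈y)) })
  }
⟦ union {σ} ⟧ᶜ = record
  { to = λ X → record
    { to   = λ Y → X ⁺++⁺ Y
    ; cong = λ (p , q) → ++-⊆ˡ (toList X) p , ++-⊆ˡ (toList X) q
    }
  ; cong = λ (p , q) Y → ++-⊆ʳ (toList Y) p , ++-⊆ʳ (toList Y) q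
  }
  where open SetoidSubsetProperties using () renaming (++⁺ʳ to ++-ʳ; ++⁺ˡ to ++-ˡ)
        ++-⊆ˡ = ++-ʳ (𝓢 σ)
        ++-⊆ʳ = ++-ˡ (𝓢 σ)
⟦ ⋃ {σ} {τ} ⟧ᶜ = record
  { to = λ X → record
    { to   = λ f → concatMap (f ⟨$⟩_) X
    ; cong = λ {f} {g} f≈g → ⋃-⊆ {σ} {τ} X X f g (λ m → m) f≈g
                           , ⋃-⊆ {σ} {τ} X X g f (λ m → m) (Setoid.sym (𝓢 (σ ⇒ τ *)) {f} {g} f≈g)
    }
  ; cong = λ {X} {Y} (p , q) f → ⋃-⊆ {σ} {τ} X Y f f p (≈-refl (σ ⇒ τ *) {f})
                               , ⋃-⊆ {σ} {τ} Y X f f q (≈-refl (σ ⇒ τ *) {f})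
  }
⟦ 𝐦 ⟧ᶜ = record
  { to   = λ X → max 0 (toList X)
  ; cong = λ (p , q) → ℕ.≤-antisym (max-mono-⊆ z≤n p) (max-mono-⊆ z≤n q)
  }

Env : Ctx target → Set
Env Δ = All ∣_∣ Δ

⟦_⟧ᵗ : ∀ {Δ τ} → Tm Δ τ → Env Δ → ∣ τ ∣
⟦ var x ⟧ᵗ δ = All.lookup δ x
⟦ con c ⟧ᵗ δ = ⟦ c ⟧ᶜ
⟦ t · u ⟧ᵗ δ = ⟦ t ⟧ᵗ δ ⟨$⟩ ⟦ u ⟧ᵗ δ

⟦_⟧ : ∀ {Δ} → Form* Δ → Env Δ → Set
⟦ _≐_ {σ} t u ⟧ δ = _≈_ {σ} (⟦ t ⟧ᵗ δ) (⟦ u ⟧ᵗ δ)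
⟦ _∈̇_ {σ} t U ⟧ δ = _∈ₛ_ {σ} (⟦ t ⟧ᵗ δ) (⟦ U ⟧ᵗ δ)
⟦ ⊥ ⟧           δ = Empty
⟦ φ ∧ ψ ⟧       δ = ⟦ φ ⟧ δ × ⟦ ψ ⟧ δ
⟦ φ ⊃ ψ ⟧       δ = ⟦ φ ⟧ δ → ⟦ ψ ⟧ δ
⟦ ∀̇ σ φ ⟧       δ = (x : ∣ σ ∣) → ⟦ φ ⟧ (x ∷ δ)
⟦ ∃̇ σ φ ⟧       δ = Σ[ x ∈ ∣ σ ∣ ] ⟦ φ ⟧ (x ∷ δ)

-- The target theory is complete and deductively closed, so provability in it
-- is membership.
T⊢_ : Form* [] → Set
T⊢ φ = ⟦ φ ⟧ []

------------------------------------------------------------------------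
-- Tuples of witnesses

infixr 6 _⇛_

_⇛_ : List (Ty target) → Ty target → Ty target
σs ⇛ τ = foldr _⇒_ τ σs

app₁ : ∀ {Δ τ} σs → Tm Δ (σs ⇛ τ) → Tms Δ σs → Tm Δ τ
app₁ []       t []       = t
app₁ (σ ∷ σs) t (u ∷ us) = app₁ σs (t · u) us

app : ∀ {Δ} σs τs → Tms Δ (map (σs ⇛_) τs) → Tms Δ σs → Tms Δ τs
app σs []       []       us = []
app σs (τ ∷ τs) (t ∷ ts) us = app₁ σs t us ∷ app σs τs ts us

-- The context βs ʳ++ Δ extends Δ by variables of types βs, the last innermost.
past : ∀ {L} (βs : List (Ty L)) {Δ} → Δ ⊆ (βs ʳ++ Δ)
past []       x = x
past (β ∷ βs) x = past βs (there x)

vars : ∀ {L} (βs : List (Ty L)) {Δ} → Tms (βs ʳ++ Δ) βs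
vars []       = []
vars (β ∷ βs) = var (past βs (here refl)) ∷ vars βs

∀̇s : ∀ βs {Δ} → Form* (βs ʳ++ Δ) → Form* Δ
∀̇s []       φ = φ
∀̇s (β ∷ βs) φ = ∀̇ β (∀̇s βs φ)

∀̇s∈ : ∀ βs {Δ} → Tms Δ (map _* βs) → Form* (βs ʳ++ Δ) → Form* Δ
∀̇s∈ []       []       φ = φ
∀̇s∈ (β ∷ βs) (X ∷ Xs) φ = ∀̇ β (var₀ ∈̇ ren there X ⊃ ∀̇s∈ βs (rens there Xs) φ)

------------------------------------------------------------------------
-- Types of the upper (Wit) and lower (Cex) tuples of an interpreted formula

-- The functions 𝐟 and 𝐠 for an implication whose premise has tuples of types
-- αs, βs and whose conclusion has tuples of types γs, δs.
module Arrow (αs βs γs δs : List (Ty target)) where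
  𝐟-types 𝐠-types : List (Ty target)
  𝐟-types = map (αs ⇛_) γs
  𝐠-types = map (αs ⇛_) (map (δs ⇛_) (map _* βs))

  Witᵃ Cexᵃ : List (Ty target)
  Witᵃ = 𝐟-types ++ 𝐠-types
  Cexᵃ = αs ++ δs

  module _ {Δ} (ws : Tms Δ Witᵃ) (cs : Tms Δ Cexᵃ) where
    𝐚 : Tms Δ αs
    𝐚 = ++⁻ˡ αs cs

    𝐝 : Tms Δ δs
    𝐝 = ++⁻ʳ αs cs

    𝐟𝐚 : Tms Δ γs
    𝐟𝐚 = app αs γs (++⁻ˡ 𝐟-types ws) 𝐚

    𝐠𝐚𝐝 : Tms Δ (map _* βs)
    𝐠𝐚𝐝 = app δs (map _* βs) (app αs (map (δs ⇛_) (map _* βs)) (++⁻ʳ 𝐟-types ws) 𝐚) 𝐝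

Wit𝓘 Cex𝓘 : Ty source → List (Ty target)
Wit𝓘 N       = N ∷ []
Wit𝓘 B       = []
Wit𝓘 (ρ ⇒ σ) = Arrow.Witᵃ (Wit𝓘 ρ) (Cex𝓘 ρ) (Wit𝓘 σ) (Cex𝓘 σ)
Cex𝓘 N       = []
Cex𝓘 B       = []
Cex𝓘 (ρ ⇒ σ) = Arrow.Cexᵃ (Wit𝓘 ρ) (Cex𝓘 ρ) (Wit𝓘 σ) (Cex𝓘 σ)

Wit Cex : ∀ {Γ} → Formᴵ Γ → List (Ty target)
Wit (t ≐ u) = []
Wit ⊥       = []
Wit (A ∧ C) = Wit A ++ Wit C
Wit (A ⊃ C) = Arrow.Witᵃ (Wit A) (Cex A) (Wit C) (Cex C)
Wit (∀̇ σ A) = Wit A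
Wit (∃̇ σ A) = Wit A
Wit (𝓘 σ t) = Wit𝓘 σ
Cex (t ≐ u) = []
Cex ⊥       = []
Cex (A ∧ C) = Cex A ++ Cex C
Cex (A ⊃ C) = Arrow.Cexᵃ (Wit A) (Cex A) (Wit C) (Cex C)
Cex (∀̇ σ A) = Cex A
Cex (∃̇ σ A) = map _* (Cex A)
Cex (𝓘 σ t) = Cex𝓘 σ

-- All these types are witnessing types, so the closed terms of types Wit A
-- are exactly the closed witnessing terms of the shape required by A.
data Witnessing : Ty target → Set where
  N   : Witnessing N
  _⇒_ : ∀ {σ τ} → Witnessing σ → Witnessing τ → Witnessing (σ ⇒ τ)
  _*  : ∀ {σ} → Witnessing σ → Witnessing (σ *)

private
  ⇛-witnessing : ∀ {σs τ} → All Witnessing σs → Witnessing τ → Witnessing (σs ⇛ τ)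
  ⇛-witnessing []       w = w
  ⇛-witnessing (v ∷ vs) w = v ⇒ ⇛-witnessing vs w

  Arrow-witnessing : ∀ {αs βs γs δs} →
    All Witnessing αs × All Witnessing βs → All Witnessing γs × All Witnessing δs →
    All Witnessing (Arrow.Witᵃ αs βs γs δs) × All Witnessing (Arrow.Cexᵃ αs βs γs δs)
  Arrow-witnessing (as , bs) (cs , ds) =
      ++⁺ (map⁺ (All.map (⇛-witnessing as) cs))
          (map⁺ (map⁺ (map⁺ (All.map (λ b → ⇛-witnessing as (⇛-witnessing ds (b *))) bs))))
    , ++⁺ as ds

𝓘-witnessing : ∀ σ → All Witnessing (Wit𝓘 σ) × All Witnessing (Cex𝓘 σ)
𝓘-witnessing N       = N ∷ [] , []
𝓘-witnessing B       = [] , []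
𝓘-witnessing (ρ ⇒ σ) = Arrow-witnessing (𝓘-witnessing ρ) (𝓘-witnessing σ)

witnessing : ∀ {Γ} (A : Formᴵ Γ) → All Witnessing (Wit A) × All Witnessing (Cex A)
witnessing (t ≐ u) = [] , []
witnessing ⊥       = [] , []
witnessing (A ∧ C) = ++⁺ (proj₁ (witnessing A)) (proj₁ (witnessing C))
                   , ++⁺ (proj₂ (witnessing A)) (proj₂ (witnessing C))
witnessing (A ⊃ C) = Arrow-witnessing (witnessing A) (witnessing C)
witnessing (∀̇ σ A) = witnessing A
witnessing (∃̇ σ A) = proj₁ (witnessing A) , map⁺ (All.map _* (proj₂ (witnessing A)))
witnessing (𝓘 σ t) = 𝓘-witnessing σ

------------------------------------------------------------------------
-- The 𝓤-interpretation with 𝓘 canonical upon bounding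

⌈_⌉ : Ty source → Ty target
⌈ N ⌉     = N
⌈ B ⌉     = B
⌈ σ ⇒ τ ⌉ = ⌈ σ ⌉ ⇒ ⌈ τ ⌉

⌈_⌉ᶜ : {σ : Ty source} → Const σ → Const ⌈ σ ⌉
⌈ 𝐤 ⌉ᶜ     = 𝐤
⌈ 𝐬 ⌉ᶜ     = 𝐬
⌈ zero ⌉ᶜ  = zero
⌈ suc ⌉ᶜ   = suc
⌈ rec ⌉ᶜ   = rec
⌈ true ⌉ᶜ  = true
⌈ false ⌉ᶜ = false
⌈ cond ⌉ᶜ  = cond

Sub : Ctx source → Ctx target → Set
Sub Γ Δ = All (λ σ → Tm Δ ⌈ σ ⌉) Γ

wkSub : ∀ {Γ Δ Δ′} → Δ ⊆ Δ′ → Sub Γ Δ → Sub Γ Δ′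
wkSub r = All.map (ren r)

⌈_⌉ᵗ : ∀ {Γ Δ} {σ : Ty source} → Tm Γ σ → Sub Γ Δ → Tm Δ ⌈ σ ⌉
⌈ var x ⌉ᵗ s = All.lookup s x
⌈ con c ⌉ᵗ s = con ⌈ c ⌉ᶜ
⌈ t · u ⌉ᵗ s = ⌈ t ⌉ᵗ s · ⌈ u ⌉ᵗ s

⟨𝓘⟩ : ∀ σ {Δ} → Tm Δ ⌈ σ ⌉ → Tms Δ (Wit𝓘 σ) → Tms Δ (Cex𝓘 σ) → Form* Δ
⟨𝓘⟩ N       x (n ∷ []) [] = x ∸ n ≐ 𝟎
⟨𝓘⟩ B       i []       [] = ⊥ ⊃ ⊥
⟨𝓘⟩ (ρ ⇒ σ) h ws       cs =
  ∀̇ ⌈ ρ ⌉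
    ( ∀̇s∈ (Cex𝓘 ρ) (rens there (𝐠𝐚𝐝 ws cs))
        (⟨𝓘⟩ ρ (ren (past (Cex𝓘 ρ)) var₀) (rens (past (Cex𝓘 ρ) ∘ there) (𝐚 ws cs)) (vars (Cex𝓘 ρ)))
    ⊃ ⟨𝓘⟩ σ (ren there h · var₀) (rens there (𝐟𝐚 ws cs)) (rens there (𝐝 ws cs)))
  where open Arrow (Wit𝓘 ρ) (Cex𝓘 ρ) (Wit𝓘 σ) (Cex𝓘 σ)

-- ⟨ A ⟩ s ws cs is ⟨A⟩^ws_cs, with the terms s substituted for the free
-- variables of A.
⟨_⟩ : ∀ {Γ Δ} (A : Formᴵ Γ) → Sub Γ Δ → Tms Δ (Wit A) → Tms Δ (Cex A) → Form* Δ
⟨ t ≐ u ⟩ s ws cs = ⌈ t ⌉ᵗ s ≐ ⌈ u ⌉ᵗ s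
⟨ ⊥ ⟩     s ws cs = ⊥
⟨ A ∧ C ⟩ s ws cs =
    ⟨ A ⟩ s (++⁻ˡ (Wit A) ws) (++⁻ˡ (Cex A) cs)
  ∧ ⟨ C ⟩ s (++⁻ʳ (Wit A) ws) (++⁻ʳ (Cex A) cs)
⟨ A ⊃ C ⟩ s ws cs =
    ∀̇s∈ (Cex A) (𝐠𝐚𝐝 ws cs)
      (⟨ A ⟩ (wkSub (past (Cex A)) s) (rens (past (Cex A)) (𝐚 ws cs)) (vars (Cex A)))
  ⊃ ⟨ C ⟩ s (𝐟𝐚 ws cs) (𝐝 ws cs)
  where open Arrow (Wit A) (Cex A) (Wit C) (Cex C)
⟨ ∀̇ σ A ⟩ s ws cs =
  ∀̇ ⌈ σ ⌉ (⟨ A ⟩ (var₀ ∷ wkSub there s) (rens there ws) (rens there cs))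
⟨ ∃̇ σ A ⟩ s ws Cs =
  ∃̇ ⌈ σ ⌉
    (∀̇s∈ (Cex A) (rens there Cs)
      (⟨ A ⟩ (ren (past (Cex A)) var₀ ∷ wkSub (past (Cex A) ∘ there) s)
             (rens (past (Cex A) ∘ there) ws) (vars (Cex A))))
⟨ 𝓘 σ t ⟩ s ws cs = ⟨𝓘⟩ σ (⌈ t ⌉ᵗ s) ws cs

𝓤-Interpretable : ∀ {Γ} → Formᴵ Γ → Set
𝓤-Interpretable {Γ} A =
  Σ[ ts ∈ Tms [] (Wit A) ]
    T⊢ ∀̇s ⌈Γ⌉ (∀̇s (Cex A)
         (⟨ A ⟩ (wkSub (past (Cex A)) (map⁻ (vars ⌈Γ⌉))) (rens (λ ()) ts) (vars (Cex A))))
  where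
  ⌈Γ⌉ : Ctx target
  ⌈Γ⌉ = map ⌈_⌉ Γ

------------------------------------------------------------------------
-- Relativization

relativize : ∀ {Γ} → Form Γ → Formᴵ Γ
relativize (t ≐ u)  = t ≐ u
relativize ⊥        = ⊥
relativize (A ∧ C)  = relativize A ∧ relativize C
relativize (A ⊃ C)  = relativize A ⊃ relativize C
relativize (∀̇ σ A)  = ∀̇ σ (𝓘 σ var₀ ⊃ relativize A)
relativize (∃̇ σ A)  = ∃̇ σ (𝓘 σ var₀ ∧ relativize A)
relativize (∀≤ k A) = ∀̇ N (var₀ ∸ ren there k ≐ 𝟎 ⊃ relativize A)
relativize (∃≤ k A) = ∃̇ N (var₀ ∸ ren there k ≐ 𝟎 ∧ relativize A)
relativize (∀≤1 A)  = ∀̇ (N ⇒ N) (∀̇ N (𝓘 N var₀ ⊃ var₁ · var₀ ∸ 𝟏 ≐ 𝟎) ⊃ relativize A)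
relativize (∃≤1 A)  = ∃̇ (N ⇒ N) (∀̇ N (𝓘 N var₀ ⊃ var₁ · var₀ ∸ 𝟏 ≐ 𝟎) ∧ relativize A)

-- ∀𝐱 (𝓘(𝐱) → A), one variable at a time: ∀x₁ (𝓘(x₁) → ∀x₂ (𝓘(x₂) → … A)).
∀𝓘 : ∀ {Γ} → Formᴵ Γ → Formᴵ []
∀𝓘 {[]}    A = A
∀𝓘 {σ ∷ Γ} A = ∀𝓘 (∀̇ σ (𝓘 σ var₀ ⊃ A))

𝓘ᶜᵇ-Interpretable : ∀ {Γ} → Form Γ → Set
𝓘ᶜᵇ-Interpretable A = 𝓤-Interpretable (∀𝓘 (relativize A))

{-# OPTIONS --safe #-}

-- The interpretations of premise and conclusion have the same upper tuple
-- n, 𝐰, 𝐠, and a lower tuple of the conclusion is a tuple 𝐃 of finite sets of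
-- lower tuples of the premise.  Since the premise is required for all members
-- of the chosen 𝐃, the copycat witness 𝐟𝐚 = 𝐚, 𝐠𝐚𝐃 = 𝐃, together with the
-- value k = n, reduces the conclusion to the premise: the upper tuple n of the
-- premise already bounds the n in ∃n C(f,n) for all f at once.
module Submission where

open import Defs
open import Data.List.Base using (List; []; _∷_; _++_; _ʳ++_; map)
open import Data.List.Membership.Propositional using (_∈_)
open import Data.List.Relation.Binary.Subset.Propositional using (_⊆_)
open import Data.List.Relation.Unary.All as All using (All; []; _∷_)
open import Data.List.Relation.Unary.All.Properties as All
  using (++⁺; ++⁻ˡ; ++⁻ʳ; map⁺; map-∘; map-cong)
open import Data.List.Relation.Unary.Any using (here; there)
open import Data.List.Relation.Binary.Subset.Propositional.Properties using (∷⁺ʳ)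
open import Data.Nat.Base using (ℕ)
import Data.Nat.Base as ℕ
import Data.Nat.Properties as ℕ
open import Data.Product.Base using (Σ-syntax; _×_; _,_)
open import Data.Product.Function.NonDependent.Propositional using (_×-⇔_)
open import Function.Base using (_∘_; id)
open import Function.Bundles using (_⟨$⟩_; _⇔_; mk⇔; Equivalence)
open import Function.Construct.Identity using (⇔-id)
open import Function.Related.TypeIsomorphisms using (→-cong-⇔)
open import Relation.Binary.PropositionalEquality using (_≡_; refl; sym; trans; cong; cong₂; subst)

open Equivalence using (to; from)

-- Congruence rules for logical equivalence

≡⇒⇔ : ∀ {X Y : Set} → X ≡ Y → X ⇔ Y
≡⇒⇔ refl = ⇔-id _

Π-cong-⇔ : ∀ {X : Set} {P Q : X → Set} → (∀ x → P x ⇔ Q x) → (∀ x → P x) ⇔ (∀ x → Q x)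
Π-cong-⇔ e = mk⇔ (λ p x → to (e x) (p x)) (λ q x → from (e x) (q x))

Σ-cong-⇔ : ∀ {X : Set} {P Q : X → Set} → (∀ x → P x ⇔ Q x) → (Σ[ x ∈ X ] P x) ⇔ (Σ[ x ∈ X ] Q x)
Σ-cong-⇔ e = mk⇔ (λ (x , p) → x , to (e x) p) (λ (x , q) → x , from (e x) q)

-- Environments and evaluation

infixr 5 _ʳ++ᴱ_

_ʳ++ᴱ_ : ∀ {βs Δ} → Env βs → Env Δ → Env (βs ʳ++ Δ)
[]       ʳ++ᴱ δ = δ
(b ∷ bs) ʳ++ᴱ δ = bs ʳ++ᴱ (b ∷ δ)

-- Stated variable by variable, so that for `there` it is `λ _ → refl`. Generic in `P` to serve
-- environments of target and of source contexts alike.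
Restricts : ∀ {I : Set} {P : I → Set} {is js : List I} → is ⊆ js → All P js → All P is → Set
Restricts {is = is} r δ γ = ∀ {i} (x : i ∈ is) → All.lookup δ (r x) ≡ All.lookup γ x

Restricts-∷⁺ʳ : ∀ {I : Set} {P : I → Set} {is js : List I} {i} {r : is ⊆ js} {δ : All P js} {γ} {p : P i} →
                Restricts r δ γ → Restricts (∷⁺ʳ i r) (p ∷ δ) (p ∷ γ)
Restricts-∷⁺ʳ ρ (here refl) = refl
Restricts-∷⁺ʳ ρ (there x)   = ρ x

past-restricts : ∀ {βs Δ} (bs : Env βs) {δ : Env Δ} → Restricts (past βs) (bs ʳ++ᴱ δ) δ
past-restricts []       x = refl
past-restricts (b ∷ bs) x = past-restricts bs (there x)

past∘there-restricts : ∀ {βs Δ σ} (bs : Env βs) {x : ∣ σ ∣} {δ : Env Δ} →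
                       Restricts (past βs ∘ there) (_ʳ++ᴱ_ {Δ = σ ∷ Δ} bs (x ∷ δ)) δ
past∘there-restricts bs y = past-restricts bs (there y)

⟦⟧-ren : ∀ {Δ Δ′ τ} {r : Δ ⊆ Δ′} {δ′ δ} → Restricts r δ′ δ → (t : Tm Δ τ) → ⟦ ren r t ⟧ᵗ δ′ ≡ ⟦ t ⟧ᵗ δ
⟦⟧-ren ρ (var x) = ρ x
⟦⟧-ren ρ (con c) = refl
⟦⟧-ren ρ (t · u) = cong₂ _⟨$⟩_ (⟦⟧-ren ρ t) (⟦⟧-ren ρ u)

-- The parameter `T` covers tuples of witnesses (`id`) and substitutions for source variables
-- (`⌈_⌉`) at once.
evalAll : ∀ {L} (T : Ty L → Ty target) {Δ σs} → Env Δ → All (λ σ → Tm Δ (T σ)) σs → All (λ σ → ∣ T σ ∣) σs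
evalAll T δ = All.map (λ t → ⟦ t ⟧ᵗ δ)

evals : ∀ {Δ σs} → Env Δ → Tms Δ σs → Env σs
evals = evalAll id

Envˢ : Ctx source → Set
Envˢ = All (λ σ → ∣ ⌈ σ ⌉ ∣)

evalSub : ∀ {Γ Δ} → Env Δ → Sub Γ Δ → Envˢ Γ
evalSub = evalAll ⌈_⌉

evalAll-ren : ∀ {L} (T : Ty L → Ty target) {Δ Δ′ σs} {r : Δ ⊆ Δ′} {δ′ δ} → Restricts r δ′ δ →
              (ts : All (λ σ → Tm Δ (T σ)) σs) → evalAll T δ′ (All.map (ren r) ts) ≡ evalAll T δ ts
evalAll-ren T ρ ts = trans (map-∘ ts) (map-cong ts (⟦⟧-ren ρ))

evals-vars : ∀ {βs Δ} (bs : Env βs) {δ : Env Δ} → evals (bs ʳ++ᴱ δ) (vars βs) ≡ bs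
evals-vars []       = refl
evals-vars (b ∷ bs) = cong₂ _∷_ (past-restricts bs (here refl)) (evals-vars bs)

⟦_⟧ˢ : ∀ {Γ} {σ : Ty source} → Tm Γ σ → Envˢ Γ → ∣ ⌈ σ ⌉ ∣
⟦ var x ⟧ˢ γ = All.lookup γ x
⟦ con c ⟧ˢ γ = ⟦ ⌈ c ⌉ᶜ ⟧ᶜ
⟦ t · u ⟧ˢ γ = ⟦ t ⟧ˢ γ ⟨$⟩ ⟦ u ⟧ˢ γ

⟦⟧ˢ-ren : ∀ {Γ Γ′ τ} {r : Γ ⊆ Γ′} {γ′ γ} → Restricts r γ′ γ → (t : Tm Γ τ) → ⟦ ren r t ⟧ˢ γ′ ≡ ⟦ t ⟧ˢ γ
⟦⟧ˢ-ren ρ (var x) = ρ x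
⟦⟧ˢ-ren ρ (con c) = refl
⟦⟧ˢ-ren ρ (t · u) = cong₂ _⟨$⟩_ (⟦⟧ˢ-ren ρ t) (⟦⟧ˢ-ren ρ u)

⟦⟧-⌈⌉ : ∀ {Γ Δ τ} (t : Tm Γ τ) (s : Sub Γ Δ) {δ} → ⟦ ⌈ t ⌉ᵗ s ⟧ᵗ δ ≡ ⟦ t ⟧ˢ (evalSub δ s)
⟦⟧-⌈⌉ (var x) s = sym (All.lookup-map s x)
⟦⟧-⌈⌉ (con c) s = refl
⟦⟧-⌈⌉ (t · u) s = cong₂ _⟨$⟩_ (⟦⟧-⌈⌉ t s) (⟦⟧-⌈⌉ u s)

-- The interpretation on semantic witnesses

app₁ˢ : ∀ {τ} σs → ∣ σs ⇛ τ ∣ → Env σs → ∣ τ ∣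
app₁ˢ []       f []       = f
app₁ˢ (σ ∷ σs) f (x ∷ xs) = app₁ˢ σs (f ⟨$⟩ x) xs

appˢ : ∀ σs τs → Env (map (σs ⇛_) τs) → Env σs → Env τs
appˢ σs []       []       xs = []
appˢ σs (τ ∷ τs) (f ∷ fs) xs = app₁ˢ σs f xs ∷ appˢ σs τs fs xs

⟦⟧-app₁ : ∀ {Δ τ} σs (t : Tm Δ (σs ⇛ τ)) us {δ} → ⟦ app₁ σs t us ⟧ᵗ δ ≡ app₁ˢ σs (⟦ t ⟧ᵗ δ) (evals δ us)
⟦⟧-app₁ []       t []       = refl
⟦⟧-app₁ (σ ∷ σs) t (u ∷ us) = ⟦⟧-app₁ σs (t · u) us

evals-app : ∀ {Δ} σs τs (ts : Tms Δ (map (σs ⇛_) τs)) us {δ} →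
            evals δ (app σs τs ts us) ≡ appˢ σs τs (evals δ ts) (evals δ us)
evals-app σs []       []       us = refl
evals-app σs (τ ∷ τs) (t ∷ ts) us = cong₂ _∷_ (⟦⟧-app₁ σs t us) (evals-app σs τs ts us)

module _ {I : Set} {P Q : I → Set} (f : ∀ {i} → P i → Q i) where
  map-++⁻ˡ : ∀ is {js} (ps : All P (is ++ js)) → All.map f (++⁻ˡ is ps) ≡ ++⁻ˡ is (All.map f ps)
  map-++⁻ˡ []       ps       = refl
  map-++⁻ˡ (i ∷ is) (p ∷ ps) = cong (_ ∷_) (map-++⁻ˡ is ps)

  map-++⁻ʳ : ∀ is {js} (ps : All P (is ++ js)) → All.map f (++⁻ʳ is ps) ≡ ++⁻ʳ is (All.map f ps)
  map-++⁻ʳ []       ps       = refl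
  map-++⁻ʳ (i ∷ is) (p ∷ ps) = map-++⁻ʳ is ps

All∈ : ∀ βs → Env (map _* βs) → (Env βs → Set) → Set
All∈ []       []       P = P []
All∈ (β ∷ βs) (X ∷ Xs) P = ∀ b → _∈ₛ_ {β} b X → All∈ βs Xs (P ∘ (b ∷_))

All∈-map : ∀ βs Xs {P Q : Env βs → Set} → (∀ bs → P bs → Q bs) → All∈ βs Xs P → All∈ βs Xs Q
All∈-map []       []       f p       = f [] p
All∈-map (β ∷ βs) (X ∷ Xs) f p b b∈X = All∈-map βs Xs (f ∘ (b ∷_)) (p b b∈X)

All∈-cong : ∀ βs Xs {P Q : Env βs → Set} → (∀ bs → P bs ⇔ Q bs) → All∈ βs Xs P ⇔ All∈ βs Xs Q
All∈-cong βs Xs e = mk⇔ (All∈-map βs Xs (to ∘ e)) (All∈-map βs Xs (from ∘ e))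

-- The equation for `Ys` absorbs the renaming of the remaining sets by `there` at each bound
-- variable.
⟦∀̇s∈⟧ : ∀ βs {Δ} {Xs : Tms Δ (map _* βs)} {φ : Form* (βs ʳ++ Δ)} {δ Ys} {P : Env βs → Set} →
        evals δ Xs ≡ Ys → ((bs : Env βs) → ⟦ φ ⟧ (bs ʳ++ᴱ δ) ⇔ P bs) → ⟦ ∀̇s∈ βs Xs φ ⟧ δ ⇔ All∈ βs Ys P
⟦∀̇s∈⟧ []       {Xs = []}     refl e = e []
⟦∀̇s∈⟧ (β ∷ βs) {Xs = X ∷ Xs} refl e = Π-cong-⇔ λ b →
  →-cong-⇔ (≡⇒⇔ (cong (_∈ₛ_ {β} b) (⟦⟧-ren (λ _ → refl) X)))
           (⟦∀̇s∈⟧ βs (evalAll-ren id (λ _ → refl) Xs) (e ∘ (b ∷_)))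

⟦∀̇s⟧ : ∀ βs {Δ} {φ : Form* (βs ʳ++ Δ)} {δ} → ((bs : Env βs) → ⟦ φ ⟧ (bs ʳ++ᴱ δ)) → ⟦ ∀̇s βs φ ⟧ δ
⟦∀̇s⟧ []       p   = p []
⟦∀̇s⟧ (β ∷ βs) p b = ⟦∀̇s⟧ βs (p ∘ (b ∷_))

module Arrowˢ (αs βs γs δs : List (Ty target)) where
  open Arrow αs βs γs δs using (𝐟-types; 𝐠-types; Witᵃ; Cexᵃ) public
  open Arrow αs βs γs δs using (𝐟𝐚; 𝐠𝐚𝐝)

  module _ (ws : Env Witᵃ) (cs : Env Cexᵃ) where
    𝐚ˢ : Env αs
    𝐚ˢ = ++⁻ˡ αs cs

    𝐝ˢ : Env δs
    𝐝ˢ = ++⁻ʳ αs cs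

    𝐟𝐚ˢ : Env γs
    𝐟𝐚ˢ = appˢ αs γs (++⁻ˡ 𝐟-types ws) 𝐚ˢ

    𝐠𝐚𝐝ˢ : Env (map _* βs)
    𝐠𝐚𝐝ˢ = appˢ δs (map _* βs) (appˢ αs (map (δs ⇛_) (map _* βs)) (++⁻ʳ 𝐟-types ws) 𝐚ˢ) 𝐝ˢ

  module _ {Δ} (ws : Tms Δ Witᵃ) (cs : Tms Δ Cexᵃ) {δ : Env Δ} where
    evals-𝐟𝐚 : evals δ (𝐟𝐚 ws cs) ≡ 𝐟𝐚ˢ (evals δ ws) (evals δ cs)
    evals-𝐟𝐚 = trans (evals-app αs γs _ _)
                     (cong₂ (appˢ αs γs) (map-++⁻ˡ _ 𝐟-types ws) (map-++⁻ˡ _ αs cs))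

    evals-𝐠𝐚𝐝 : evals δ (𝐠𝐚𝐝 ws cs) ≡ 𝐠𝐚𝐝ˢ (evals δ ws) (evals δ cs)
    evals-𝐠𝐚𝐝 = trans (evals-app δs (map _* βs) _ _)
      (cong₂ (appˢ δs (map _* βs))
        (trans (evals-app αs _ _ _)
               (cong₂ (appˢ αs _) (map-++⁻ʳ _ 𝐟-types ws) (map-++⁻ˡ _ αs cs)))
        (map-++⁻ʳ _ αs cs))

Rel : List (Ty target) → List (Ty target) → Set₁
Rel αs βs = Env αs → Env βs → Set

module _ {αs βs γs δs : List (Ty target)} where
  open Arrowˢ αs βs γs δs

  Imp : Rel αs βs → Rel γs δs → Rel Witᵃ Cexᵃ
  Imp P Q ws cs = All∈ βs (𝐠𝐚𝐝ˢ ws cs) (P (𝐚ˢ ws cs)) → Q (𝐟𝐚ˢ ws cs) (𝐝ˢ ws cs)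

  Con : Rel αs βs → Rel γs δs → Rel (αs ++ γs) (βs ++ δs)
  Con P Q ws cs = P (++⁻ˡ αs ws) (++⁻ˡ βs cs) × Q (++⁻ʳ αs ws) (++⁻ʳ βs cs)

Ex : ∀ {αs βs} {X : Set} → (X → Rel αs βs) → Rel αs (map _* βs)
Ex {βs = βs} {X} P ws Cs = Σ[ x ∈ X ] All∈ βs Cs (P x ws)

-- At `N` the bound is the value of the same recursor term that `⟨𝓘⟩` uses, so the two agree by
-- computation.
Sem𝓘 : ∀ σ → ∣ ⌈ σ ⌉ ∣ → Rel (Wit𝓘 σ) (Cex𝓘 σ)
Sem𝓘 N       x (n ∷ []) [] = ⟦ var₀ ∸ var₁ ⟧ᵗ (x ∷ n ∷ []) ≡ 0
Sem𝓘 B       x []       [] = ⟦ ⊥ {Δ = []} ⊃ ⊥ ⟧ []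
Sem𝓘 (ρ ⇒ σ) h ws       cs = ∀ x → Imp (Sem𝓘 ρ x) (Sem𝓘 σ (h ⟨$⟩ x)) ws cs

-- The interpretation read directly on functions and finite sets: all substitution and renaming of
-- target terms disappears.
Sem : ∀ {Γ} (A : Formᴵ Γ) → Envˢ Γ → Rel (Wit A) (Cex A)
Sem (_≐_ {σ} t u) γ ws cs = _≈_ {⌈ σ ⌉} (⟦ t ⟧ˢ γ) (⟦ u ⟧ˢ γ)
Sem ⊥             γ ws cs = ⟦ ⊥ ⟧ []
Sem (A ∧ C)       γ       = Con (Sem A γ) (Sem C γ)
Sem (A ⊃ C)       γ       = Imp (Sem A γ) (Sem C γ)
Sem (∀̇ σ A)       γ ws cs = ∀ x → Sem A (x ∷ γ) ws cs
Sem (∃̇ σ A)       γ       = Ex (λ x → Sem A (x ∷ γ))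
Sem (𝓘 σ t)       γ       = Sem𝓘 σ (⟦ t ⟧ˢ γ)

-- Agreement of the syntactic with the semantic interpretation

⟦⟨𝓘⟩⟧ : ∀ σ {Δ} (t : Tm Δ ⌈ σ ⌉) ws cs {δ : Env Δ} {x w c} →
        ⟦ t ⟧ᵗ δ ≡ x → evals δ ws ≡ w → evals δ cs ≡ c →
        ⟦ ⟨𝓘⟩ σ t ws cs ⟧ δ ⇔ Sem𝓘 σ x w c
⟦⟨𝓘⟩⟧ N       t (n ∷ []) [] refl refl refl = ⇔-id _
⟦⟨𝓘⟩⟧ B       t []       [] refl refl refl = ⇔-id _
⟦⟨𝓘⟩⟧ (ρ ⇒ σ) t ws       cs refl refl refl = Π-cong-⇔ λ x → →-cong-⇔
  (⟦∀̇s∈⟧ (Cex𝓘 ρ) (trans (evalAll-ren id (λ _ → refl) _) (evals-𝐠𝐚𝐝 ws cs)) λ bs →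
    ⟦⟨𝓘⟩⟧ ρ _ _ _
      (past-restricts bs (here refl))
      (trans (evalAll-ren id (past∘there-restricts bs) _) (map-++⁻ˡ _ (Wit𝓘 ρ) cs))
      (evals-vars bs))
  (⟦⟨𝓘⟩⟧ σ _ _ _
    (cong (_⟨$⟩ x) (⟦⟧-ren (λ _ → refl) t))
    (trans (evalAll-ren id (λ _ → refl) _) (evals-𝐟𝐚 ws cs))
    (trans (evalAll-ren id (λ _ → refl) _) (map-++⁻ʳ _ (Wit𝓘 ρ) cs)))
  where open Arrowˢ (Wit𝓘 ρ) (Cex𝓘 ρ) (Wit𝓘 σ) (Cex𝓘 σ)

-- Values enter through equations, so that each recursive call can cite how evaluation commutes with
-- renaming, splitting and application of tuples.
⟦⟨⟩⟧ : ∀ {Γ Δ} (A : Formᴵ Γ) (s : Sub Γ Δ) ws cs {δ : Env Δ} {γ w c} →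
       evalSub δ s ≡ γ → evals δ ws ≡ w → evals δ cs ≡ c →
       ⟦ ⟨ A ⟩ s ws cs ⟧ δ ⇔ Sem A γ w c
⟦⟨⟩⟧ (_≐_ {σ} t u) s ws cs refl refl refl = ≡⇒⇔ (cong₂ (_≈_ {⌈ σ ⌉}) (⟦⟧-⌈⌉ t s) (⟦⟧-⌈⌉ u s))
⟦⟨⟩⟧ ⊥ s ws cs refl refl refl = ⇔-id _
⟦⟨⟩⟧ (A ∧ C) s ws cs refl refl refl =
  ⟦⟨⟩⟧ A s _ _ refl (map-++⁻ˡ _ (Wit A) ws) (map-++⁻ˡ _ (Cex A) cs) ×-⇔
  ⟦⟨⟩⟧ C s _ _ refl (map-++⁻ʳ _ (Wit A) ws) (map-++⁻ʳ _ (Cex A) cs)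
⟦⟨⟩⟧ (A ⊃ C) s ws cs refl refl refl = →-cong-⇔
  (⟦∀̇s∈⟧ (Cex A) (evals-𝐠𝐚𝐝 ws cs) λ bs →
    ⟦⟨⟩⟧ A _ _ _
      (evalAll-ren ⌈_⌉ (past-restricts bs) s)
      (trans (evalAll-ren id (past-restricts bs) _) (map-++⁻ˡ _ (Wit A) cs))
      (evals-vars bs))
  (⟦⟨⟩⟧ C s _ _ refl (evals-𝐟𝐚 ws cs) (map-++⁻ʳ _ (Wit A) cs))
  where open Arrowˢ (Wit A) (Cex A) (Wit C) (Cex C)
⟦⟨⟩⟧ (∀̇ σ A) s ws cs refl refl refl = Π-cong-⇔ λ x →
  ⟦⟨⟩⟧ A _ _ _
    (cong (x ∷_) (evalAll-ren ⌈_⌉ (λ _ → refl) s))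
    (evalAll-ren id (λ _ → refl) ws)
    (evalAll-ren id (λ _ → refl) cs)
⟦⟨⟩⟧ (∃̇ σ A) s ws Cs refl refl refl = Σ-cong-⇔ λ x →
  ⟦∀̇s∈⟧ (Cex A) (evalAll-ren id (λ _ → refl) Cs) λ bs →
    ⟦⟨⟩⟧ A _ _ _
      (cong₂ _∷_ (past-restricts bs (here refl)) (evalAll-ren ⌈_⌉ (past∘there-restricts bs) s))
      (evalAll-ren id (past∘there-restricts bs) ws)
      (evals-vars bs)
⟦⟨⟩⟧ (𝓘 σ t) s ws cs refl refl refl = ⟦⟨𝓘⟩⟧ σ _ ws cs (⟦⟧-⌈⌉ t s) refl refl

-- Closed witnessing terms

default : ∀ {Δ : Ctx target} τ → Tm Δ τ
default N       = con zero
default B       = con true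
default (σ ⇒ τ) = con 𝐤 · default τ
default (σ *)   = con singleton · default σ

module _ {Δ : Ctx target} where
  constant : ∀ {τ} σs → Tm Δ τ → Tm Δ (σs ⇛ τ)
  constant []       t = t
  constant (σ ∷ σs) t = con 𝐤 · constant σs t

  app₁ˢ-constant : ∀ {τ} σs (t : Tm Δ τ) {δ} xs → app₁ˢ σs (⟦ constant σs t ⟧ᵗ δ) xs ≡ ⟦ t ⟧ᵗ δ
  app₁ˢ-constant []       t []       = refl
  app₁ˢ-constant (σ ∷ σs) t (x ∷ xs) = app₁ˢ-constant σs t xs

  constants : ∀ σs {τs} → Tms Δ τs → Tms Δ (map (σs ⇛_) τs)
  constants σs = map⁺ ∘ All.map (constant σs)

  appˢ-constants : ∀ σs {τs} (ts : Tms Δ τs) {δ} xs → appˢ σs τs (evals δ (constants σs ts)) xs ≡ evals δ ts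
  appˢ-constants σs []       xs = refl
  appˢ-constants σs (t ∷ ts) xs = cong₂ _∷_ (app₁ˢ-constant σs t xs) (appˢ-constants σs ts xs)

  -- The combinator form of λx y₁...yₘ. x: prefixing `𝐬 (𝐤 𝐤)` composes with `𝐤` and so discards one
  -- more argument.
  first : ∀ σs {τ} → Tm Δ (τ ⇒ (σs ⇛ τ))
  -- The identity as `𝐬 𝐤 𝐤`; `N` fixes a type that the result type leaves open.
  first []       = con 𝐬 · con 𝐤 · con (𝐤 {σ = _} {τ = N})
  first (σ ∷ σs) = con 𝐬 · (con 𝐤 · con 𝐤) · first σs

  app₁ˢ-first : ∀ σs {τ δ x} xs → app₁ˢ σs (⟦ first σs {τ} ⟧ᵗ δ ⟨$⟩ x) xs ≡ x
  app₁ˢ-first []       []       = refl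
  app₁ˢ-first (σ ∷ σs) (x ∷ xs) = app₁ˢ-first σs xs

  projection : ∀ {σs τ} → τ ∈ σs → Tm Δ (σs ⇛ τ)
  projection {σ ∷ σs} (here refl) = first σs
  projection {σ ∷ σs} (there i)   = con 𝐤 · projection i

  app₁ˢ-projection : ∀ {σs τ} (i : τ ∈ σs) {δ} xs → app₁ˢ σs (⟦ projection i ⟧ᵗ δ) xs ≡ All.lookup xs i
  app₁ˢ-projection {σ ∷ σs} (here refl) (x ∷ xs) = app₁ˢ-first σs xs
  app₁ˢ-projection {σ ∷ σs} (there i)   (x ∷ xs) = app₁ˢ-projection i xs

  projections : ∀ σs → Tms Δ (map (σs ⇛_) σs)
  projections σs = map⁺ (All.tabulate projection)

  -- The induction shortens the list of results `τs` while the arguments `σs` stay whole, hence two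
  -- separate lists and an arbitrary family `t`.
  appˢ-tabulate : ∀ σs {τs} (t : ∀ {τ} → τ ∈ τs → Tm Δ (σs ⇛ τ)) {δ} xs (ys : Env τs) →
                  (∀ {τ} (i : τ ∈ τs) → app₁ˢ σs (⟦ t i ⟧ᵗ δ) xs ≡ All.lookup ys i) →
                  appˢ σs τs (evals δ (map⁺ (All.tabulate t))) xs ≡ ys
  appˢ-tabulate σs t xs []       e = refl
  appˢ-tabulate σs t xs (y ∷ ys) e =
    cong₂ _∷_ (e (here refl)) (appˢ-tabulate σs (t ∘ there) xs ys (e ∘ there))

  appˢ-projections : ∀ σs {δ} xs → appˢ σs σs (evals δ (projections σs)) xs ≡ xs
  appˢ-projections σs xs = appˢ-tabulate σs projection xs xs (λ i → app₁ˢ-projection i xs)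

  module _ {σs τs : List (Ty target)} (ts : Tms Δ σs) (us : Tms Δ τs) {δ : Env Δ} where
    evals-++⁺ˡ : ++⁻ˡ σs (evals δ (++⁺ ts us)) ≡ evals δ ts
    evals-++⁺ˡ = trans (sym (map-++⁻ˡ _ σs _)) (cong (evals δ) (++⁻ˡ∘++⁺ ts))
      where
      ++⁻ˡ∘++⁺ : ∀ {σs} (ts : Tms Δ σs) → ++⁻ˡ σs (++⁺ ts us) ≡ ts
      ++⁻ˡ∘++⁺ []       = refl
      ++⁻ˡ∘++⁺ (t ∷ ts) = cong (t ∷_) (++⁻ˡ∘++⁺ ts)

    evals-++⁺ʳ : ++⁻ʳ σs (evals δ (++⁺ ts us)) ≡ evals δ us
    evals-++⁺ʳ = trans (sym (map-++⁻ʳ _ σs _)) (cong (evals δ) (++⁻ʳ∘++⁺ ts))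
      where
      ++⁻ʳ∘++⁺ : ∀ {σs} (ts : Tms Δ σs) → ++⁻ʳ σs (++⁺ ts us) ≡ us
      ++⁻ʳ∘++⁺ []       = refl
      ++⁻ʳ∘++⁺ (t ∷ ts) = ++⁻ʳ∘++⁺ ts

-- Witnesses for implications

module _ {αs βs γs δs : List (Ty target)} (ts : Tms [] γs) where
  open Arrowˢ αs βs γs δs

  weakening : Tms [] Witᵃ
  weakening = ++⁺ (constants αs ts) (All.tabulate (λ _ → default _))

  -- The constant 𝐟 returns `ts`, at which `Q` already holds outright; hence the default terms
  -- suffice for 𝐠.
  weakening-witnesses : ∀ {P : Rel αs βs} {Q : Rel γs δs} → (∀ d → Q (evals [] ts) d) →
                        ∀ cs → Imp P Q (evals [] weakening) cs
  weakening-witnesses {Q = Q} q cs _ = subst (λ c → Q c (𝐝ˢ (evals [] weakening) cs)) (sym 𝐟𝐚≡ts) (q _)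
    where
    𝐟𝐚≡ts : 𝐟𝐚ˢ (evals [] weakening) cs ≡ evals [] ts
    𝐟𝐚≡ts = trans (cong (λ fs → appˢ αs γs fs _) (evals-++⁺ˡ (constants αs ts) _)) (appˢ-constants αs ts _)

module _ {αs βs : List (Ty target)} where
  open Arrowˢ αs βs αs (map _* βs)

  copycat : Tms [] Witᵃ
  copycat = ++⁺ (projections αs) (constants αs (projections (map _* βs)))

  -- As 𝐟 projects from 𝐚, and 𝐠 is constant in 𝐚 and projects from 𝐃, `Imp P Q` evaluates to the
  -- hypothesis at `a` and `D`.
  copycat-witnesses : ∀ {P : Rel αs βs} {Q : Rel αs (map _* βs)} →
                      (∀ a D → All∈ βs D (P a) → Q a D) → ∀ cs → Imp P Q (evals [] copycat) cs
  copycat-witnesses {P} {Q} q cs p =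
    subst (λ c → Q c D) (sym 𝐟𝐚≡𝐚) (q a D (subst (λ X → All∈ βs X (P a)) 𝐠𝐚𝐝≡𝐝 p))
    where
    a = 𝐚ˢ (evals [] copycat) cs
    D = 𝐝ˢ (evals [] copycat) cs

    𝐟𝐚≡𝐚 : 𝐟𝐚ˢ (evals [] copycat) cs ≡ a
    𝐟𝐚≡𝐚 = trans (cong (λ fs → appˢ αs αs fs a) (evals-++⁺ˡ (projections αs) _)) (appˢ-projections αs a)

    𝐠𝐚𝐝≡𝐝 : 𝐠𝐚𝐝ˢ (evals [] copycat) cs ≡ D
    𝐠𝐚𝐝≡𝐝 = trans
      (cong (λ gs → appˢ (map _* βs) (map _* βs) gs D)
        (trans (cong (λ gs → appˢ αs _ gs a) (evals-++⁺ʳ (projections αs) _))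
               (appˢ-constants αs (projections (map _* βs)) a)))
      (appˢ-projections (map _* βs) D)

-- Interpretability

-- An interpretation carries its types of witnesses, since Wit and Cex are
-- invariant under renaming only up to propositional equality.
record Interp (Γ : Ctx source) : Set₁ where
  constructor interp
  field
    {wit cex} : List (Ty target)
    rel       : Envˢ Γ → Rel wit cex

open Interp

⌊_⌋ : ∀ {Γ} → Formᴵ Γ → Interp Γ
⌊ A ⌋ = interp (Sem A)

-- The closed witnesses are chosen before `γ`: they are uniform in the free variables.
Interpretable : ∀ {Γ} → Interp Γ → Set
Interpretable {Γ} I = Σ[ ts ∈ Tms [] (wit I) ] ((γ : Envˢ Γ) → ∀ cs → rel I γ (evals [] ts) cs)

𝓤-interpretable : ∀ (A : Formᴵ []) → Interpretable ⌊ A ⌋ → 𝓤-Interpretable A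
𝓤-interpretable A (ts , p) = ts , ⟦∀̇s⟧ (Cex A) λ cs →
  from (⟦⟨⟩⟧ A _ _ _ refl (evalAll-ren id (λ ()) ts) (evals-vars cs)) (p [] cs)

-- Uniform witnesses work for every value of a variable, so each added premise `𝓘 σ var₀` is
-- absorbed by weakening.
∀𝓘-interpretable : ∀ {Γ} (A : Formᴵ Γ) → Interpretable ⌊ A ⌋ → 𝓤-Interpretable (∀𝓘 A)
∀𝓘-interpretable {[]}    A p        = 𝓤-interpretable A p
∀𝓘-interpretable {σ ∷ Γ} A (ts , p) = ∀𝓘-interpretable (∀̇ σ (𝓘 σ var₀ ⊃ A))
  ( weakening {Wit𝓘 σ} {Cex𝓘 σ} {δs = Cex A} ts
  , λ γ cs x → weakening-witnesses ts {Sem𝓘 σ x} {Sem A (x ∷ γ)} (p (x ∷ γ)) cs)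

infixr 4 _∧ᴵ_
infixr 3 _⊃ᴵ_

-- These mirror the clauses of `Sem`: `⌊ A ⊃ C ⌋` computes to `⌊ A ⌋ ⊃ᴵ ⌊ C ⌋`, and likewise for the
-- other connectives.
_∧ᴵ_ _⊃ᴵ_ : ∀ {Γ} → Interp Γ → Interp Γ → Interp Γ
interp P ∧ᴵ interp Q = interp (λ γ → Con (P γ) (Q γ))
interp P ⊃ᴵ interp Q = interp (λ γ → Imp (P γ) (Q γ))

∀ᴵ ∃ᴵ : ∀ {Γ} σ → Interp (σ ∷ Γ) → Interp Γ
∀ᴵ σ (interp P) = interp (λ γ ws cs → ∀ x → P (x ∷ γ) ws cs)
∃ᴵ σ (interp P) = interp (λ γ → Ex (λ x → P (x ∷ γ)))

-- Renaming

-- An inductive family, so that matching on `renames` identifies the witness types of both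
-- interpretations and no transport along equations of types arises.
data Renaming {Γ Δ} (r : Γ ⊆ Δ) : Interp Γ → Interp Δ → Set₁ where
  renames : ∀ {αs βs} {P : Envˢ Γ → Rel αs βs} {Q : Envˢ Δ → Rel αs βs} →
            (∀ {δ : Envˢ Δ} {γ : Envˢ Γ} → Restricts r δ γ → ∀ ws cs → P γ ws cs ⇔ Q δ ws cs) →
            Renaming r (interp P) (interp Q)

module _ {Γ Δ : Ctx source} {r : Γ ⊆ Δ} where
  ∧-renaming : ∀ {I J I′ J′} → Renaming r I I′ → Renaming r J J′ → Renaming r (I ∧ᴵ J) (I′ ∧ᴵ J′)
  ∧-renaming (renames e) (renames f) = renames λ ρ ws cs → e ρ _ _ ×-⇔ f ρ _ _

  ⊃-renaming : ∀ {I J I′ J′} → Renaming r I I′ → Renaming r J J′ → Renaming r (I ⊃ᴵ J) (I′ ⊃ᴵ J′)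
  ⊃-renaming (renames e) (renames f) = renames λ ρ ws cs →
    →-cong-⇔ (All∈-cong _ _ (e ρ _)) (f ρ _ _)

  ∀-renaming : ∀ {σ I I′} → Renaming (∷⁺ʳ σ r) I I′ → Renaming r (∀ᴵ σ I) (∀ᴵ σ I′)
  ∀-renaming (renames e) = renames λ ρ ws cs → Π-cong-⇔ λ x → e (Restricts-∷⁺ʳ ρ) ws cs

  ∃-renaming : ∀ {σ I I′} → Renaming (∷⁺ʳ σ r) I I′ → Renaming r (∃ᴵ σ I) (∃ᴵ σ I′)
  ∃-renaming (renames e) = renames λ ρ ws Cs → Σ-cong-⇔ λ x →
    All∈-cong _ Cs (e (Restricts-∷⁺ʳ ρ) ws)

  𝓘var₀-renaming : ∀ {σ} → Renaming (∷⁺ʳ σ r) ⌊ 𝓘 σ var₀ ⌋ ⌊ 𝓘 σ var₀ ⌋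
  𝓘var₀-renaming {σ} = renames λ ρ ws cs → ≡⇒⇔ (cong (λ x → Sem𝓘 σ x ws cs) (sym (ρ (here refl))))

≤-renaming : ∀ {Γ Δ} {r : Γ ⊆ Δ} (k : Tm Γ N) →
             Renaming (∷⁺ʳ N r) ⌊ var₀ ∸ ren there k ≐ 𝟎 ⌋ ⌊ var₀ ∸ ren there (ren r k) ≐ 𝟎 ⌋
≤-renaming {Γ} {Δ} {r} k = renames λ ρ ws cs →
  ≡⇒⇔ (cong₂ (λ m n → ⟦ var₀ ∸ var₁ ⟧ᵗ (m ∷ n ∷ []) ≡ 0) (sym (ρ (here refl))) (bound ρ))
  where
  -- Both sides equal the value of `k` at the tail of `γ`; the terms are compared by value, not by
  -- syntax.
  bound : ∀ {δ : Envˢ (N ∷ Δ)} {γ : Envˢ (N ∷ Γ)} → Restricts (∷⁺ʳ N r) δ γ →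
          ⟦ ren there k ⟧ˢ γ ≡ ⟦ ren there (ren r k) ⟧ˢ δ
  bound {_ ∷ δ} {_ ∷ γ} ρ =
    trans (⟦⟧ˢ-ren {γ = γ} (λ _ → refl) k)
   (trans (sym (⟦⟧ˢ-ren {γ′ = δ} (λ x → ρ (there x)) k)) (sym (⟦⟧ˢ-ren {γ = δ} (λ _ → refl) (ren r k))))

≤1ᶠ : ∀ {Γ} → Formᴵ ((N ⇒ N) ∷ Γ)
≤1ᶠ = ∀̇ N (𝓘 N var₀ ⊃ var₁ · var₀ ∸ 𝟏 ≐ 𝟎)

≤1-renaming : ∀ {Γ Δ} {r : Γ ⊆ Δ} → Renaming (∷⁺ʳ (N ⇒ N) r) ⌊ ≤1ᶠ ⌋ ⌊ ≤1ᶠ ⌋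
≤1-renaming = renames λ ρ ws cs → ≡⇒⇔ (cong (λ f → Sem ≤1ᶠ (f ∷ []) ws cs) (sym (ρ (here refl))))

-- Needed because `C` stands under the extra variable k in the conclusion: its copy there keeps the
-- witness types and the meaning.
relativize-renaming : ∀ {Γ Δ} (r : Γ ⊆ Δ) (A : Form Γ) →
                      Renaming r ⌊ relativize A ⌋ ⌊ relativize (renForm r A) ⌋
relativize-renaming r (_≐_ {σ} t u) = renames λ ρ _ _ →
  ≡⇒⇔ (cong₂ (_≈_ {⌈ σ ⌉}) (sym (⟦⟧ˢ-ren ρ t)) (sym (⟦⟧ˢ-ren ρ u)))
relativize-renaming r ⊥        = renames λ _ _ _ → ⇔-id _
relativize-renaming r (A ∧ C)  = ∧-renaming (relativize-renaming r A) (relativize-renaming r C)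
relativize-renaming r (A ⊃ C)  = ⊃-renaming (relativize-renaming r A) (relativize-renaming r C)
relativize-renaming r (∀̇ σ A)  = ∀-renaming (⊃-renaming 𝓘var₀-renaming (relativize-renaming _ A))
relativize-renaming r (∃̇ σ A)  = ∃-renaming (∧-renaming 𝓘var₀-renaming (relativize-renaming _ A))
relativize-renaming r (∀≤ k A) = ∀-renaming (⊃-renaming (≤-renaming k) (relativize-renaming _ A))
relativize-renaming r (∃≤ k A) = ∃-renaming (∧-renaming (≤-renaming k) (relativize-renaming _ A))
relativize-renaming r (∀≤1 A)  = ∀-renaming (⊃-renaming ≤1-renaming (relativize-renaming _ A))
relativize-renaming r (∃≤1 A)  = ∃-renaming (∧-renaming ≤1-renaming (relativize-renaming _ A))

-- The collection principle

-- Serves to bound k by itself in `𝓘 N`. The recursor term is first identified with subtraction on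
-- `ℕ`.
k∸k≡0 : ∀ k → ⟦ var₀ ∸ var₁ ⟧ᵗ (k ∷ k ∷ []) ≡ 0
k∸k≡0 k = trans (is-∸ k) (ℕ.n∸n≡0 k)
  where
  pred-is-pred : ∀ n → recursor 0 (λ m _ → m) n ≡ ℕ.pred n
  pred-is-pred ℕ.zero    = refl
  pred-is-pred (ℕ.suc n) = refl

  is-∸ : ∀ n → ⟦ var₀ ∸ var₁ ⟧ᵗ (k ∷ n ∷ []) ≡ k ℕ.∸ n
  is-∸ ℕ.zero    = refl
  is-∸ (ℕ.suc n) = trans (pred-is-pred (⟦ var₀ ∸ var₁ ⟧ᵗ (k ∷ n ∷ [])))
                         (trans (cong ℕ.pred (is-∸ n)) (ℕ.pred[m∸n]≡m∸[1+n] k n))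

premise : ∀ {Γ} → Interp (N ∷ (N ⇒ N) ∷ Γ) → Interp Γ
premise I = ∀ᴵ (N ⇒ N) (⌊ ≤1ᶠ ⌋ ⊃ᴵ ∃ᴵ N (⌊ 𝓘 N var₀ ⌋ ∧ᴵ I))

-- The upper tuple matches that of `premise`: the bound on n moves to the front as the bound on k,
-- and the restricted ∃n ≤ k adds no witness of its own.
conclusion : ∀ {Γ} → Interp (N ∷ (N ⇒ N) ∷ N ∷ Γ) → Interp Γ
conclusion J =
  ∃ᴵ N (⌊ 𝓘 N var₀ ⌋ ∧ᴵ ∀ᴵ (N ⇒ N) (⌊ ≤1ᶠ ⌋ ⊃ᴵ ∃ᴵ N (⌊ var₀ ∸ ren there var₁ ≐ 𝟎 ⌋ ∧ᴵ J)))

collection : ∀ {Γ} {I : Interp (N ∷ (N ⇒ N) ∷ Γ)} {J} →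
             Renaming (∷⁺ʳ N (∷⁺ʳ (N ⇒ N) there)) I J → Interpretable (premise I ⊃ᴵ conclusion J)
collection (renames {βs = βs} {P} {Q} e) =
  copycat {wit (premise (interp P))} {cex (premise (interp P))} , λ γ →
  copycat-witnesses {P = Prem γ} {Q = rel (conclusion (interp Q)) γ}
    -- `n` is both the value chosen for k and its bound; `p` gives the premise for each `D` in `DD`.
    λ { (n ∷ ws) DD p → n , All∈-map (map _* βs) DD (λ D q → k∸k≡0 n , bounded n ws D q) p }
  where
  Prem = rel (premise (interp P))

  -- With k set to `n`, the premise's `𝓘 N` bound on the witness is literally the restriction n ≤ k.
  bounded : ∀ {γ} n ws D → Prem γ (n ∷ ws) D →
            rel (∀ᴵ (N ⇒ N) (⌊ ≤1ᶠ ⌋ ⊃ᴵ ∃ᴵ N (⌊ var₀ ∸ ren there var₁ ≐ 𝟎 ⌋ ∧ᴵ interp Q))) (n ∷ γ) ws D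
  -- `f≤1` passes over unchanged, since both sides test `f` against the same finite sets given by 𝐠.
  bounded n ws D q f f≤1 with m , r ← q f f≤1 =
    m , All∈-map βs D (λ d (m≤n , c) →
      m≤n , to (e (Restricts-∷⁺ʳ (Restricts-∷⁺ʳ λ _ → refl)) _ d) c) r

theorem9p18 : ∀ {Γ : Ctx source} (C : Form (N ∷ (N ⇒ N) ∷ Γ)) →
    𝓘ᶜᵇ-Interpretable
      ( ∀≤1 (∃̇ N C)
      ⊃ ∃̇ N (∀≤1 (∃≤ var₁ (renForm (∷⁺ʳ N (∷⁺ʳ (N ⇒ N) there)) C))) )
-- The parameters `Γ` of `C` are closed off by `∀𝓘-interpretable`; the renaming inserts k beneath f
-- and n.
theorem9p18 C = ∀𝓘-interpretable _ (collection (relativize-renaming _ C))
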